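{- Let $\mathcal{F}$ be a class of graphs. The following four statements are equivalent: (i) $\mathcal{F}$ is linearly $\sigma$-bounded, i.e. $\sup \chi(\Sigma)/\rho(\Sigma) < \infty$, where the supremum is over all $G \in \mathcal{F}$ and all neighborhood systems $\Sigma$ for $G$ with $\rho(\Sigma)\ge 1$; (ii) $\mathcal{F}$ is $\sigma$-bounded, i.e. there is a function $f$ such that every $G\in\mathcal{F}$ and every neighborhood system $\Sigma$ for $G$ satisfy $\chi(\Sigma)\le f(\rho(\Sigma))$; (iii) the supremum of $\chi(\Sigma)$ over all $G\in\mathcal{F}$ and all neighborhood systems $\Sigma$ for $G$ with $\rho(\Sigma)=2$ is finite; (iv) $\mathcal{F}$ has bounded star chromatic number, i.e. $\sup_{G\in\mathcal{F}}\chi_s(G)<\infty$.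
   Context: Graphs are finite, simple and undirected. For a graph $G=(V,E)$, a neighborhood system for $G$ is a collection $\Sigma=(\Sigma(v))_{v\in V}$ with $\Sigma(v)\subseteq N(v)$ for each $v$, where $N(v)$ is the set of neighbors of $v$. A $\Sigma$-coloring is an assignment of colors to the vertices so that any two distinct vertices that both belong to some common set $\Sigma(w)$ receive different colors (it need not be a proper coloring of $G$). $\chi(\Sigma)$ is the minimum number of colors in a $\Sigma$-coloring, and $\rho(\Sigma)=\max_{v\in V}|\Sigma(v)|$. A star coloring of $G$ is a proper vertex coloring such that every two color classes induce a forest of stars (equivalently, no path on four vertices is 2-colored); $\chi_s(G)$, the star chromatic number, is the least number of colors in a star coloring of $G$. -}

module Defs where

open import Data.Nat using (ℕ; zero; suc; _⊔_; _*_; _≤_)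
open import Data.Fin using (Fin; zero; suc)
open import Data.Fin.Subset using (Subset; _∈_; _∉_; ∣_∣)
open import Data.Product using (Σ; ∃; _×_; _,_)
open import Relation.Binary.PropositionalEquality using (_≡_; _≢_)
open import Relation.Nullary using (¬_)
open import Function.Bundles using (_⇔_)

record Graph (n : ℕ) : Set where
  field
    adj    : Fin n → Subset n
    sym    : ∀ u v → u ∈ adj v → v ∈ adj u
    irrefl : ∀ v → v ∉ adj v
open Graph public

GraphClass : Set₁
GraphClass = ∀ {n} → Graph n → Set

record NbhSystem {n : ℕ} (G : Graph n) : Set where
  field
    nbh : Fin n → Subset n
    sub : ∀ v u → u ∈ nbh v → u ∈ adj G v
open NbhSystem public

maxFin : ∀ {n} → (Fin n → ℕ) → ℕ
maxFin {zero}  f = 0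
maxFin {suc n} f = f zero ⊔ maxFin (λ i → f (suc i))

ρ : ∀ {n} {G : Graph n} → NbhSystem G → ℕ
ρ S = maxFin (λ v → ∣ nbh S v ∣)

IsΣColoring : ∀ {n k} {G : Graph n} → NbhSystem G → (Fin n → Fin k) → Set
IsΣColoring {n} S c = ∀ (w u v : Fin n) → u ∈ nbh S w → v ∈ nbh S w → u ≢ v → c u ≢ c v

χ≤ : ∀ {n} {G : Graph n} → NbhSystem G → ℕ → Set
χ≤ {n} S k = Σ (Fin n → Fin k) (IsΣColoring S)

IsProper : ∀ {n k} → Graph n → (Fin n → Fin k) → Set
IsProper G c = ∀ u v → v ∈ adj G u → c u ≢ c v

-- star colouring: proper and no (not necessarily induced) path a-b-c-d on four
-- distinct vertices is 2-coloured
IsStarColoring : ∀ {n k} → Graph n → (Fin n → Fin k) → Set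
IsStarColoring {n} G c =
  IsProper G c ×
  (∀ (a b x d : Fin n) → a ≢ x → b ≢ d → a ≢ d →
     b ∈ adj G a → x ∈ adj G b → d ∈ adj G x →
     ¬ (c a ≡ c x × c b ≡ c d))

χs≤ : ∀ {n} → Graph n → ℕ → Set
χs≤ {n} G k = Σ (Fin n → Fin k) (IsStarColoring G)

LinearlyσBounded : GraphClass → Set
LinearlyσBounded F = ∃ λ (C : ℕ) → ∀ {n} (G : Graph n) → F G →
  (S : NbhSystem G) → 1 ≤ ρ S → χ≤ S (C * ρ S)

σBounded : GraphClass → Set
σBounded F = ∃ λ (f : ℕ → ℕ) → ∀ {n} (G : Graph n) → F G →
  (S : NbhSystem G) → χ≤ S (f (ρ S))

σ₂Bounded : GraphClass → Set
σ₂Bounded F = ∃ λ (K : ℕ) → ∀ {n} (G : Graph n) → F G →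
  (S : NbhSystem G) → ρ S ≡ 2 → χ≤ S K

BoundedStarChromatic : GraphClass → Set
BoundedStarChromatic F = ∃ λ (K : ℕ) → ∀ {n} (G : Graph n) → F G → χs≤ G K

{-# OPTIONS --safe #-}
module Submission where

-- Star colouring ⇒ linear bound.  If u and v have the same star colour and a common
-- neighbour w, then w is the centre of a bicoloured star containing both; u has at most one
-- such w of each colour, so u conflicts with at most K ρ vertices of its own colour, and
-- each colour class can be recoloured greedily.
--
-- Bounded χ(Σ) for ρ = 2 ⇒ star colouring.  Let bs be a set of vertices and as the set of
-- vertices with at least 2 + K neighbours in bs.  Choosing, one v ∈ as at a time, a pair of
-- neighbours of v in bs that is monochromatic in a constant fraction of the colourings of bs
-- still alive leaves none alive once |as| exceeds a constant times |bs|, so |as| = O(|bs|).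
-- In a vertex set S, greedily picking vertices with many neighbours among those that still
-- have few neighbours in bs yields a small bs such that most of S has few neighbours in bs
-- and few, on average, outside it.  Hence the graph is degenerate and has an acyclic
-- orientation of out-degree at most d.  A vertex is then separated from the heads of directed
-- paths of length at most 2 by a greedy colouring, and two out-neighbours of a common vertex
-- by d² colourings of systems with ρ ≤ 2; the product colouring is a star colouring.

open import Defs renaming (sym to adj-sym)
open import Data.Fin using (Fin; zero; suc; toℕ; combine; funToFin; finToFun; inject≤)
import Data.Fin.Properties as F
open import Data.Fin.Subset using (Subset; inside; outside; ∣_∣; _∪_; _∩_; ⁅_⁆) renaming (_∈_ to _∈ₛ_)
open import Data.Fin.Subset.Properties
  using (_∈?_; x∈p∪q⁺; x∈p∩q⁺; x∈p∩q⁻; x∈⁅x⁆; ∣⁅x⁆∣≡1; ∣p∩q∣≤∣p∣; x∈p⇒∣p-x∣<∣p∣; x∈p∧x≢y⇒x∈p-y)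
open import Data.List as L
  using (List; []; _∷_; _++_; length; map; concatMap; filter; allFin; cartesianProduct; cartesianProductWith)
open import Data.List.Membership.Propositional using (_∈_; find; lose)
open import Data.List.Membership.Propositional.Properties
open import Data.List.Properties using (length-map; length-++; length-filter; length-tabulate; filter-notAll)
open import Data.List.Relation.Unary.All as All using ([]; _∷_)
open import Data.List.Relation.Unary.AllPairs using ([]; _∷_)
open import Data.List.Relation.Unary.Any as Any using (here; there; index)
open import Data.List.Relation.Unary.Any.Properties using (lookup-index)
open import Data.List.Relation.Unary.Unique.Propositional using (Unique)
import Data.List.Relation.Unary.Unique.Propositional.Properties as Unique
open import Data.Bool using (true; false; if_then_else_)
open import Data.Nat
open import Data.Nat.Properties hiding (_≟_)
open import Data.Nat.Tactic.RingSolver using (solve-∀)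
open import Data.Product using (∃; _×_; _,_; proj₁; proj₂)
open import Data.Sum using (_⊎_; inj₁; inj₂)
open import Data.Vec using ([]; _∷_; here; there)
open import Function using (_∘_)
open import Function.Bundles using (_⇔_; mk⇔)
open import Function.Definitions using (Injective)
open import Level using (Level)
open import Relation.Binary.Definitions using (DecidableEquality; tri<; tri≈; tri>)
open import Relation.Binary.PropositionalEquality hiding ([_])
open import Relation.Nullary using (Dec; does; _because_; ¬_; yes; no; contradiction)
open import Relation.Nullary.Decidable using (¬?; _×-dec_)
open import Relation.Unary using (Decidable)
open import Algebra.Properties.CommutativeSemigroup *-commutativeSemigroup
  using (interchange; x∙yz≈y∙xz; x∙yz≈yx∙z; xy∙z≈xz∙y)
import Algebra.Properties.CommutativeSemigroup +-commutativeSemigroup as +-CS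

private variable
  a p : Level
  A B : Set a
  n : ℕ

-- Finite sums, indicators and averaging over lists.

∑ : List A → (A → ℕ) → ℕ
∑ []       f = 0
∑ (x ∷ xs) f = f x + ∑ xs f

𝟙 : {P : Set p} → Dec P → ℕ
𝟙 d = if does d then 1 else 0

∑-mono : ∀ (xs : List A) {f g} → (∀ {x} → x ∈ xs → f x ≤ g x) → ∑ xs f ≤ ∑ xs g
∑-mono []       h = z≤n
∑-mono (x ∷ xs) h = +-mono-≤ (h (here refl)) (∑-mono xs (h ∘ there))

∑-cong : ∀ (xs : List A) {f g} → (∀ {x} → x ∈ xs → f x ≡ g x) → ∑ xs f ≡ ∑ xs g
∑-cong []       h = refl
∑-cong (x ∷ xs) h = cong₂ _+_ (h (here refl)) (∑-cong xs (h ∘ there))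

∑-const : ∀ (xs : List A) c → ∑ xs (λ _ → c) ≡ length xs * c
∑-const []       c = refl
∑-const (x ∷ xs) c = cong (c +_) (∑-const xs c)

∑-+ : ∀ (xs : List A) f g → ∑ xs (λ x → f x + g x) ≡ ∑ xs f + ∑ xs g
∑-+ []       f g = refl
∑-+ (x ∷ xs) f g rewrite ∑-+ xs f g = +-CS.interchange (f x) (g x) (∑ xs f) (∑ xs g)

∑-swap : ∀ (xs : List A) (ys : List B) (f : A → B → ℕ) →
         ∑ xs (λ x → ∑ ys (f x)) ≡ ∑ ys (λ y → ∑ xs (λ x → f x y))
∑-swap []       ys f = sym (trans (∑-const ys 0) (*-zeroʳ (length ys)))
∑-swap (x ∷ xs) ys f =
  trans (cong (∑ ys (f x) +_) (∑-swap xs ys f)) (sym (∑-+ ys (f x) _))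

∑-≤const : ∀ (xs : List A) {f c} → (∀ {x} → x ∈ xs → f x ≤ c) → ∑ xs f ≤ length xs * c
∑-≤const xs {c = c} h = ≤-trans (∑-mono xs h) (≤-reflexive (∑-const xs c))

∑-≥const : ∀ (xs : List A) {f c} → (∀ {x} → x ∈ xs → c ≤ f x) → length xs * c ≤ ∑ xs f
∑-≥const xs {c = c} h = ≤-trans (≤-reflexive (sym (∑-const xs c))) (∑-mono xs h)

∑-filter : ∀ {P : A → Set p} (P? : Decidable P) (xs : List A) f →
           ∑ (filter P? xs) f ≡ ∑ xs (λ x → 𝟙 (P? x) * f x)
∑-filter P? []       f = refl
∑-filter P? (x ∷ xs) f with P? x
... | true  because _ = cong₂ _+_ (sym (+-identityʳ (f x))) (∑-filter P? xs f)
... | false because _ = ∑-filter P? xs f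

length-filter≡∑ : ∀ {P : A → Set p} (P? : Decidable P) (xs : List A) →
                  length (filter P? xs) ≡ ∑ xs (λ x → 𝟙 (P? x))
length-filter≡∑ P? []       = refl
length-filter≡∑ P? (x ∷ xs) with P? x
... | true  because _ = cong suc (length-filter≡∑ P? xs)
... | false because _ = length-filter≡∑ P? xs

length-filter-¬ : ∀ {P : A → Set p} (P? : Decidable P) (xs : List A) →
                  length (filter P? xs) + length (filter (¬? ∘ P?) xs) ≡ length xs
length-filter-¬ P? []       = refl
length-filter-¬ P? (x ∷ xs) with P? x
... | true  because _ = cong suc (length-filter-¬ P? xs)
... | false because _ = trans (+-suc _ _) (cong suc (length-filter-¬ P? xs))

f≤∑ : ∀ {xs : List A} {x} f → x ∈ xs → f x ≤ ∑ xs f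
f≤∑ f (here refl) = m≤m+n _ _
f≤∑ f (there x∈)  = ≤-trans (f≤∑ f x∈) (m≤n+m _ _)

𝟙-yes : {P : Set p} (d : Dec P) → P → 𝟙 d ≡ 1
𝟙-yes (yes _) _ = refl
𝟙-yes (no ¬p) p = contradiction p ¬p

𝟙-no : {P : Set p} (d : Dec P) → ¬ P → 𝟙 d ≡ 0
𝟙-no (yes p) ¬p = contradiction p ¬p
𝟙-no (no _)  _  = refl

maximiser : ∀ {xs : List A} {x₀} (f : A → ℕ) → x₀ ∈ xs →
            ∃ λ x → x ∈ xs × (∀ {y} → y ∈ xs → f y ≤ f x)
maximiser {xs = x ∷ []}     f _ = x , here refl , λ { (here refl) → ≤-refl }
maximiser {xs = x ∷ y ∷ ys} f _ with maximiser {xs = y ∷ ys} f (here refl)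
... | m , m∈ , max with ≤-total (f x) (f m)
...   | inj₁ fx≤fm = m , there m∈ , λ { (here refl) → fx≤fm ; (there z∈) → max z∈ }
...   | inj₂ fm≤fx = x , here refl ,
        λ { (here refl) → ≤-refl ; (there z∈) → ≤-trans (max z∈) fm≤fx }

minimiser : ∀ {xs : List A} {x₀} (f : A → ℕ) → x₀ ∈ xs →
            ∃ λ x → x ∈ xs × (∀ {y} → y ∈ xs → f x ≤ f y)
minimiser {xs = x ∷ []}     f _ = x , here refl , λ { (here refl) → ≤-refl }
minimiser {xs = x ∷ y ∷ ys} f _ with minimiser {xs = y ∷ ys} f (here refl)
... | m , m∈ , min with ≤-total (f x) (f m)
...   | inj₂ fm≤fx = m , there m∈ , λ { (here refl) → fm≤fx ; (there z∈) → min z∈ }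
...   | inj₁ fx≤fm = x , here refl ,
        λ { (here refl) → ≤-refl ; (there z∈) → ≤-trans fx≤fm (min z∈) }

-- Double counting: each `c` is related to some `p`, so there are at least `length cs` related
-- pairs, and a `p` lying in the most pairs has at least the average number.
popular : ∀ {ps : List A} {p₀} (cs : List B) {R : A → B → Set p} (R? : ∀ p c → Dec (R p c)) →
          p₀ ∈ ps → (∀ c → ∃ λ p → p ∈ ps × R p c) →
          ∃ λ p → p ∈ ps × length cs ≤ length ps * length (filter (R? p) cs)
popular {ps = ps} cs R? p₀∈ cover
  with p , p∈ , max ← maximiser (λ p → ∑ cs (λ c → 𝟙 (R? p c))) p₀∈ = p , p∈ , (begin
    length cs                                ≡⟨ *-identityʳ _ ⟨
    length cs * 1                            ≤⟨ ∑-≥const cs (λ {c} _ → covered c) ⟩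
    ∑ cs (λ c → ∑ ps (λ q → 𝟙 (R? q c)))     ≡⟨ ∑-swap cs ps _ ⟩
    ∑ ps (λ q → ∑ cs (λ c → 𝟙 (R? q c)))     ≤⟨ ∑-≤const ps max ⟩
    length ps * ∑ cs (λ c → 𝟙 (R? p c))      ≡⟨ cong (length ps *_) (length-filter≡∑ (R? p) cs) ⟨
    length ps * length (filter (R? p) cs)    ∎)
  where
  open ≤-Reasoning
  covered : ∀ c → 1 ≤ ∑ ps (λ q → 𝟙 (R? q c))
  covered c with q , q∈ , Rqc ← cover c = begin
    1                        ≡⟨ 𝟙-yes (R? q c) Rqc ⟨
    𝟙 (R? q c)               ≤⟨ f≤∑ (λ q → 𝟙 (R? q c)) q∈ ⟩
    ∑ ps (λ q → 𝟙 (R? q c))  ∎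

𝟙-mono : ∀ {q} {P : Set p} {Q : Set q} (d : Dec P) (e : Dec Q) → (P → Q) → 𝟙 d ≤ 𝟙 e
𝟙-mono (no _)  e P⇒Q = z≤n
𝟙-mono (yes p) e P⇒Q = ≤-reflexive (sym (𝟙-yes e (P⇒Q p)))

𝟙≤1 : {P : Set p} (d : Dec P) → 𝟙 d ≤ 1
𝟙≤1 (yes _) = ≤-refl
𝟙≤1 (no _)  = z≤n

lookup-injective : ∀ {xs : List A} → Unique xs → Injective _≡_ _≡_ (L.lookup xs)
lookup-injective (x∉ ∷ _)  {zero}  {zero}  _  = refl
lookup-injective (x∉ ∷ _)  {zero}  {suc j} eq = contradiction eq (All.lookup x∉ (∈-lookup j))
lookup-injective (x∉ ∷ _)  {suc i} {zero}  eq = contradiction (sym eq) (All.lookup x∉ (∈-lookup i))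
lookup-injective (_ ∷ uxs) {suc i} {suc j} eq = cong suc (lookup-injective uxs eq)

-- Index pairs and the arithmetic of the counting argument.

distinctPairs : ∀ n → List (Fin n × Fin n)
distinctPairs n =
  filter (λ ij → ¬? (proj₁ ij F.≟ proj₂ ij)) (cartesianProduct (allFin n) (allFin n))

∈-distinctPairs⁺ : ∀ {i j : Fin n} → i ≢ j → (i , j) ∈ distinctPairs n
∈-distinctPairs⁺ {i = i} {j} i≢j =
  ∈-filter⁺ _ (∈-cartesianProduct⁺ (∈-allFin i) (∈-allFin j)) i≢j

∈-distinctPairs⁻ : ∀ {i j : Fin n} → (i , j) ∈ distinctPairs n → i ≢ j
∈-distinctPairs⁻ {n} ij∈ =
  proj₂ (∈-filter⁻ (λ ij → ¬? (proj₁ ij F.≟ proj₂ ij))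
                   {xs = cartesianProduct (allFin n) (allFin n)} ij∈)

-- If the `m` discarded items are at least a fraction `1/r` of all, the `s` survivors are at most a
-- fraction `r/(r+1)`. The sharper `(r-1)/r` is relaxed to avoid subtraction.
discard-popular : ∀ r s m → s + m ≤ r * m → suc r * s ≤ r * (s + m)
discard-popular r s m h = begin
  s + r * s      ≤⟨ +-monoˡ-≤ (r * s) (≤-trans (m≤m+n s m) h) ⟩
  r * m + r * s  ≡⟨ +-comm (r * m) (r * s) ⟩
  r * s + r * m  ≡⟨ *-distribˡ-+ r s m ⟨
  r * (s + m)    ∎
  where open ≤-Reasoning

^-distribʳ-* : ∀ m n o → (m * n) ^ o ≡ m ^ o * n ^ o
^-distribʳ-* m n zero    = refl
^-distribʳ-* m n (suc o) =
  trans (cong (m * n *_) (^-distribʳ-* m n o)) (interchange m n (m ^ o) (n ^ o))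

-- Bernoulli's inequality for `1 + 1/q`, multiplied by `q ^ suc s` to stay within the naturals.
bernoulli : ∀ q s → q ^ s * (q + s) ≤ q * suc q ^ s
bernoulli q zero    = ≤-reflexive (lemma q)
  where
  lemma : ∀ q → 1 * (q + 0) ≡ q * 1
  lemma = solve-∀
bernoulli q (suc s) = begin
  q ^ suc s * (q + suc s)                ≡⟨ lemma q (q ^ s) s ⟩
  q ^ s * (q * q + q * suc s)            ≤⟨ *-monoʳ-≤ (q ^ s) (m≤n+m _ s) ⟩
  q ^ s * (s + (q * q + q * suc s))      ≡⟨ lemma′ q (q ^ s) s ⟩
  suc q * (q ^ s * (q + s))              ≤⟨ *-monoʳ-≤ (suc q) (bernoulli q s) ⟩
  suc q * (q * suc q ^ s)                ≡⟨ lemma″ q (suc q ^ s) ⟩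
  q * suc q ^ suc s                      ∎
  where
  open ≤-Reasoning
  lemma : ∀ q x s → q * x * (q + suc s) ≡ x * (q * q + q * suc s)
  lemma = solve-∀
  lemma′ : ∀ q x s → x * (s + (q * q + q * suc s)) ≡ suc q * (x * (q + s))
  lemma′ = solve-∀
  lemma″ : ∀ q y → suc q * (q * y) ≡ q * (suc q * y)
  lemma″ = solve-∀

-- Bernoulli: (1 + 1/r) ^ s ≥ 1 + s/r ≥ K for s = K (r + 1).
^-gain : ∀ r K → r ^ (K * suc r) * K ≤ suc r ^ (K * suc r)
^-gain zero    zero    = z≤n
^-gain zero    (suc K) = z≤n
^-gain (suc r) K = *-cancelˡ-≤ (suc r) (begin
  suc r * (suc r ^ s * K)     ≡⟨ lemma (suc r) (suc r ^ s) K ⟩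
  suc r ^ s * (K * suc r)     ≤⟨ *-monoʳ-≤ (suc r ^ s) (≤-trans (*-monoʳ-≤ K (n≤1+n (suc r))) (m≤n+m s (suc r))) ⟩
  suc r ^ s * (suc r + s)     ≤⟨ bernoulli (suc r) s ⟩
  suc r * suc (suc r) ^ s     ∎)
  where
  open ≤-Reasoning
  s = K * suc (suc r)
  lemma : ∀ q x K → q * (x * K) ≡ x * (K * q)
  lemma = solve-∀

-- Otherwise `a = C * b + e` with `e > 0`. By `^-gain`, each of `b` blocks of `C` factors `r`,
-- together with one factor `K`, is at most `suc r ^ C`; the `e` leftover factors then make the
-- inequality strict, contradicting the hypothesis.
exponent-bound : ∀ r K a b → suc r ^ a ≤ r ^ a * K ^ b → a ≤ K * suc r * b
exponent-bound r K a b h = ≮⇒≥ λ Cb<a → <-irrefl refl (begin-strict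
  suc r ^ a                              ≤⟨ h ⟩
  r ^ a * K ^ b                          ≡⟨ cong (λ a → r ^ a * K ^ b) (m+[n∸m]≡n (<⇒≤ Cb<a)) ⟨
  r ^ (C * b + e) * K ^ b                ≡⟨ cong (_* K ^ b) (^-distribˡ-+-* r (C * b) e) ⟩
  r ^ (C * b) * r ^ e * K ^ b            ≡⟨ xy∙z≈xz∙y (r ^ (C * b)) (r ^ e) (K ^ b) ⟩
  r ^ (C * b) * K ^ b * r ^ e            ≡⟨ cong (λ x → x * K ^ b * r ^ e) (^-*-assoc r C b) ⟨
  (r ^ C) ^ b * K ^ b * r ^ e            ≡⟨ cong (_* r ^ e) (^-distribʳ-* (r ^ C) K b) ⟨
  (r ^ C * K) ^ b * r ^ e                ≤⟨ *-monoˡ-≤ (r ^ e) (^-monoˡ-≤ b (^-gain r K)) ⟩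
  (suc r ^ C) ^ b * r ^ e                ≡⟨ cong (_* r ^ e) (^-*-assoc (suc r) C b) ⟩
  suc r ^ (C * b) * r ^ e                <⟨ *-monoʳ-< (suc r ^ (C * b)) {{m^n≢0 (suc r) (C * b)}}
                                              (^-monoˡ-< e {{>-nonZero (m<n⇒0<n∸m Cb<a)}} ≤-refl) ⟩
  suc r ^ (C * b) * suc r ^ e            ≡⟨ ^-distribˡ-+-* (suc r) (C * b) e ⟨
  suc r ^ (C * b + e)                    ≡⟨ cong (suc r ^_) (m+[n∸m]≡n (<⇒≤ Cb<a)) ⟩
  suc r ^ a                              ∎)
  where
  open ≤-Reasoning
  C = K * suc r
  e = a ∸ C * b

-- Explicit constants.

-- What `exponent-bound` yields for `suc K` colours and the pairs among `2 + K` neighbours, one more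
-- neighbour than colours.
slope : ℕ → ℕ
slope K = suc K * suc (length (distinctPairs (2 + K)))

-- Up to `M` neighbours inside the greedily chosen set and up to twice the greedy threshold
-- `M * (2 * C)` outside it.
degeneracy : ℕ → ℕ → ℕ
degeneracy M C = M + M * (2 * C) * 2

-- Greedy colours against directed paths of length at most 2, times one palette of size `suc K` for
-- each of the `d * d` pairs of out-neighbour positions.
starBound : ℕ → ℕ → ℕ
starBound K d = suc (d + d * d) * (suc K ^ d) ^ d

length-cartesianProductWith : ∀ {C : Set a} (f : A → B → C) xs ys →
  length (cartesianProductWith f xs ys) ≡ length xs * length ys
length-cartesianProductWith f []       ys = refl
length-cartesianProductWith f (x ∷ xs) ys =
  trans (length-++ (map (f x) ys)) (cong₂ _+_ (length-map (f x) ys) (length-cartesianProductWith f xs ys))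

-- Enumerating the colourings of a list of vertices.

module _ {V : Set} (_≟_ : DecidableEquality V) where

  _[_≔_] : (V → A) → V → A → V → A
  (f [ v ≔ x ]) u = if does (u ≟ v) then x else f u

  ≔-here : ∀ (f : V → A) v {x} → (f [ v ≔ x ]) v ≡ x
  ≔-here f v with v ≟ v
  ... | yes _  = refl
  ... | no v≢v = contradiction refl v≢v

  ≔-there : ∀ (f : V → A) {u v x} → u ≢ v → (f [ v ≔ x ]) u ≡ f u
  ≔-there f {u} {v} u≢v with u ≟ v
  ... | yes u≡v = contradiction u≡v u≢v
  ... | no _    = refl

  -- A colouring of the list is represented by a total function that is `zero` off the list, so
  -- completeness can only mean agreement on the list.
  colourings : ∀ K → List V → List (V → Fin (suc K))
  colourings K []       = (λ _ → zero) ∷ []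
  colourings K (v ∷ vs) = cartesianProductWith (λ x c → c [ v ≔ x ]) (allFin (suc K)) (colourings K vs)

  length-colourings : ∀ K vs → length (colourings K vs) ≡ suc K ^ length vs
  length-colourings K []       = refl
  length-colourings K (v ∷ vs) = trans
    (length-cartesianProductWith _ (allFin (suc K)) (colourings K vs))
    (cong₂ _*_ (length-tabulate {n = suc K} (λ i → i)) (length-colourings K vs))

  colourings-complete : ∀ {K} vs (c : V → Fin (suc K)) →
    ∃ λ c′ → c′ ∈ colourings K vs × (∀ {v} → v ∈ vs → c′ v ≡ c v)
  colourings-complete []       c = _ , here refl , λ ()
  colourings-complete (v ∷ vs) c with c′ , c′∈ , c′≡c ← colourings-complete vs c =
    _ , ∈-cartesianProductWith⁺ _ (∈-allFin (c v)) c′∈ , agree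
    where
    agree : ∀ {u} → u ∈ v ∷ vs → (c′ [ v ≔ c v ]) u ≡ c u
    agree {u} u∈ with u ≟ v | u∈
    ... | yes refl | _         = refl
    ... | no u≢v   | here u≡v  = contradiction u≡v u≢v
    ... | no _     | there u∈′ = c′≡c u∈′

  -- Few vertices have many neighbours in a small set.

  module _ {E : V → V → Set} (E? : ∀ u v → Dec (E u v)) where

    record Fork (bs : List V) (v x y : V) : Set where
      field
        x∈  : x ∈ bs
        y∈  : y ∈ bs
        Ex  : E v x
        Ey  : E v y
        x≢y : x ≢ y

    many-neighbours : ∀ {k v bs} → Unique bs → k ≤ length (filter (E? v) bs) →
      ∃ λ (w : Fin k → V) → Injective _≡_ _≡_ w × (∀ i → w i ∈ bs × E v (w i))
    many-neighbours {v = v} {bs} ubs k≤ =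
      (λ i → L.lookup (filter (E? v) bs) (inject≤ i k≤)) ,
      (λ eq → F.inject≤-injective k≤ k≤ _ _ (lookup-injective (Unique.filter⁺ (E? v) ubs) eq)) ,
      (λ i → ∈-filter⁻ (E? v) {xs = bs} (∈-lookup (inject≤ i k≤)))

    -- By pigeonhole every colouring makes some pair of the chosen 2 + K neighbours of v
    -- monochromatic, so one pair does so for at least 1/r of cs; cs′ is what survives it.
    kill-one : ∀ {K v bs} → Unique bs → 2 + K ≤ length (filter (E? v) bs) →
      (cs : List (V → Fin (suc K))) → let r = length (distinctPairs (2 + K)) in
      ∃ λ x → ∃ λ y → ∃ λ (cs′ : List (V → Fin (suc K))) →
        Fork bs v x y ×
        (∀ {c} → c ∈ cs → c x ≢ c y → c ∈ cs′) ×
        suc r * length cs′ ≤ r * length cs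
    kill-one {K} {v} {bs} ubs many cs
      with w , w-inj , w-nbr ← many-neighbours ubs many
      with (i , j) , ij∈ , popular-ij ← popular cs (λ ij c → c (w (proj₁ ij)) F.≟ c (w (proj₂ ij)))
             -- Any pair will do here; it only shows that the list of pairs is non-empty.
             (∈-distinctPairs⁺ {i = zero} {suc zero} λ ())
             (λ c → let i , j , i<j , eq = F.pigeonhole ≤-refl (c ∘ w)
                    in (i , j) , ∈-distinctPairs⁺ (F.<⇒≢ i<j) , eq)
      = w i , w j , filter (¬? ∘ mono?) cs
      , record { x∈ = proj₁ (w-nbr i) ; y∈ = proj₁ (w-nbr j)
               ; Ex = proj₂ (w-nbr i) ; Ey = proj₂ (w-nbr j)
               ; x≢y = ∈-distinctPairs⁻ ij∈ ∘ w-inj }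
      , ∈-filter⁺ (¬? ∘ mono?)
      , subst (λ l → suc r * s ≤ r * l) s+m≡ (discard-popular r s m (subst (_≤ r * m) (sym s+m≡) popular-ij))
      where
      mono? : Decidable (λ c → c (w i) ≡ c (w j))
      mono? c = c (w i) F.≟ c (w j)
      r = length (distinctPairs (2 + K))
      s = length (filter (¬? ∘ mono?) cs)
      m = length (filter mono? cs)
      s+m≡ : s + m ≡ length cs
      s+m≡ = trans (+-comm s m) (length-filter-¬ mono? cs)

    -- Iterates `kill-one`, each vertex acting on the survivors of the one before, so the factors
    -- `r / suc r` multiply. The chosen pairs are recorded in `f` and `g`: a listed colouring that
    -- separates all of them cannot have been discarded.
    kill : ∀ {K bs} → Unique bs → ∀ {as} → Unique as →
      (∀ {v} → v ∈ as → 2 + K ≤ length (filter (E? v) bs)) →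
      (cs : List (V → Fin (suc K))) → let r = length (distinctPairs (2 + K)) in
      ∃ λ f → ∃ λ g → ∃ λ (cs′ : List (V → Fin (suc K))) →
        (∀ {v} → v ∈ as → Fork bs v (f v) (g v)) ×
        (∀ {c} → c ∈ cs → (∀ {v} → v ∈ as → c (f v) ≢ c (g v)) → c ∈ cs′) ×
        suc r ^ length as * length cs′ ≤ r ^ length as * length cs
    -- Off `as` both functions return `v` itself, so no pair has to be separated there.
    kill ubs {[]}     _ many cs = (λ v → v) , (λ v → v) , cs , (λ ()) , (λ c∈ _ → c∈) , ≤-refl
    kill {K} {bs} ubs {a ∷ as} (a∉ ∷ uas) many cs
      with x , y , cs₁ , fork₁ , keep₁ , few₁ ← kill-one ubs (many (here refl)) cs
      with f , g , cs₂ , forks , keep₂ , few₂ ← kill ubs uas (many ∘ there) cs₁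
      = f [ a ≔ x ] , g [ a ≔ y ] , cs₂ , forks′ , keep , few
      where
      r = length (distinctPairs (2 + K))
      same : ∀ (h : V → V) {z v} → v ∈ as → (h [ a ≔ z ]) v ≡ h v
      same h v∈ = ≔-there h (λ v≡a → All.lookup a∉ v∈ (sym v≡a))
      forks′ : ∀ {v} → v ∈ a ∷ as → Fork bs v ((f [ a ≔ x ]) v) ((g [ a ≔ y ]) v)
      forks′ (here refl) = subst₂ (Fork bs a) (sym (≔-here f a)) (sym (≔-here g a)) fork₁
      forks′ (there v∈)  = subst₂ (Fork bs _) (sym (same f v∈)) (sym (same g v∈)) (forks v∈)
      keep : ∀ {c} → c ∈ cs → (∀ {v} → v ∈ a ∷ as → c ((f [ a ≔ x ]) v) ≢ c ((g [ a ≔ y ]) v)) → c ∈ cs₂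
      keep {c} c∈ sep = keep₂ (keep₁ c∈ (subst₂ (λ p q → c p ≢ c q) (≔-here f a) (≔-here g a) (sep (here refl))))
        (λ v∈ → subst₂ (λ p q → c p ≢ c q) (same f v∈) (same g v∈) (sep (there v∈)))
      few : suc r ^ length (a ∷ as) * length cs₂ ≤ r ^ length (a ∷ as) * length cs
      few = begin
        suc r * suc r ^ length as * length cs₂    ≡⟨ *-assoc (suc r) (suc r ^ length as) _ ⟩
        suc r * (suc r ^ length as * length cs₂)  ≤⟨ *-monoʳ-≤ (suc r) few₂ ⟩
        suc r * (r ^ length as * length cs₁)      ≡⟨ x∙yz≈y∙xz (suc r) (r ^ length as) (length cs₁) ⟩
        r ^ length as * (suc r * length cs₁)      ≤⟨ *-monoʳ-≤ (r ^ length as) few₁ ⟩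
        r ^ length as * (r * length cs)           ≡⟨ x∙yz≈yx∙z (r ^ length as) r (length cs) ⟩
        r * r ^ length as * length cs             ∎
        where open ≤-Reasoning

    -- f and g encode the neighbourhood system Σ(v) = {f v, g v} ∩ N(v), for which ρ ≤ 2.
    ForkColourable : ℕ → Set
    ForkColourable K = ∀ (f g : V → V) → ∃ λ (c : V → Fin (suc K)) →
      ∀ v → E v (f v) → E v (g v) → f v ≢ g v → c (f v) ≢ c (g v)

    FewRich : (M C : ℕ) → Set
    FewRich M C = ∀ {bs as} → Unique bs → Unique as →
      (∀ {v} → v ∈ as → M ≤ length (filter (E? v) bs)) → length as ≤ C * length bs

    -- Start from all colourings of `bs`. The colouring supplied for `f` and `g` separates every
    -- chosen pair, and the pairs lie in `bs`, so the listed colouring agreeing with it on `bs`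
    -- survives. Hence the upper bound on the number of survivors is at least 1.
    few-rich : ∀ {K} → ForkColourable K → FewRich (2 + K) (slope K)
    few-rich {K} colour {bs} {as} ubs uas rich
      with f , g , cs′ , forks , keep , few ← kill ubs uas rich (colourings K bs)
      with c , sep ← colour f g
      with c′ , c′∈ , c′≡c ← colourings-complete bs c
      = exponent-bound r (suc K) (length as) (length bs) (begin
          suc r ^ length as                                ≡⟨ *-identityʳ _ ⟨
          suc r ^ length as * 1                            ≤⟨ *-monoʳ-≤ (suc r ^ length as) (∈-length c′∈cs′) ⟩
          suc r ^ length as * length cs′                   ≤⟨ few ⟩
          r ^ length as * length (colourings K bs)         ≡⟨ cong (r ^ length as *_) (length-colourings K bs) ⟩
          r ^ length as * suc K ^ length bs                ∎)
      where
      open ≤-Reasoning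
      r = length (distinctPairs (2 + K))
      c′∈cs′ : c′ ∈ cs′
      c′∈cs′ = keep c′∈ λ v∈ → let open Fork (forks v∈) in
        subst₂ _≢_ (sym (c′≡c x∈)) (sym (c′≡c y∈)) (sep _ Ex Ey x≢y)

    -- A vertex of low degree in every non-empty set.

    deg : List V → V → ℕ
    deg xs v = ∑ xs (λ x → 𝟙 (E? v x))

    module _ (M t : ℕ) (S : List V) where

      gain : List V → V → ℕ
      gain bs x = ∑ S (λ u → 𝟙 (deg bs u <? M) * 𝟙 (E? u x))

      gain-antitone : ∀ b bs x → gain (b ∷ bs) x ≤ gain bs x
      gain-antitone b bs x = ∑-mono S λ {u} _ → *-monoˡ-≤ (𝟙 (E? u x))
        (𝟙-mono (deg (b ∷ bs) u <? M) (deg bs u <? M) (≤-<-trans (m≤n+m _ _)))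

      ⊓-step : ∀ d e (d<?M : Dec (d < M)) → e ≤ 1 → 𝟙 d<?M * e + M ⊓ d ≤ M ⊓ (e + d)
      ⊓-step d e (yes d<M) e≤1 = ⊓-glb
              (≤-trans (+-mono-≤ (≤-trans (≤-reflexive (*-identityˡ e)) e≤1) (m⊓n≤n M d)) d<M)
              (+-mono-≤ (≤-reflexive (*-identityˡ e)) (m⊓n≤n M d))
      ⊓-step d e (no _)    e≤1 = ⊓-monoʳ-≤ M (m≤n+m d e)

      -- The cap keeps the potential at most `M * length S`, while every accepted vertex raises it
      -- by at least `t`; together these limit `length bs`.
      potential : List V → ℕ
      potential bs = ∑ S (λ u → M ⊓ deg bs u)

      potential-step : ∀ b bs → gain bs b + potential bs ≤ potential (b ∷ bs)
      potential-step b bs = ≤-trans (≤-reflexive (sym (∑-+ S _ _)))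
        (∑-mono S λ {u} _ → ⊓-step (deg bs u) (𝟙 (E? u b)) (deg bs u <? M) (𝟙≤1 (E? u b)))

      -- gain bs x bounds from below what adding x to bs contributes to the potential.  It only
      -- decreases as bs grows, so a single pass suffices: a rejected x stays poor.
      record Greedy (xs : List V) : Set where
        field
          bs rs     : List V
          bs-unique : Unique bs
          bs⊆       : ∀ {x} → x ∈ bs → x ∈ xs
          split     : ∀ f → ∑ xs f ≡ ∑ bs f + ∑ rs f
          bs-few    : length bs * t ≤ potential bs
          rs-poor   : ∀ {x} → x ∈ rs → gain bs x ≤ t

      greedy : ∀ {xs} → Unique xs → Greedy xs
      greedy {[]} _ = record
        { bs = [] ; rs = [] ; bs-unique = [] ; bs⊆ = λ () ; split = λ _ → refl
        ; bs-few = z≤n ; rs-poor = λ () }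
      greedy {x ∷ xs} (x∉ ∷ uxs) = decide (t ≤? gain bs x)
        where
        open Greedy (greedy uxs)
        decide : Dec (t ≤ gain bs x) → Greedy (x ∷ xs)
        decide (yes t≤) = record
          { bs = x ∷ bs ; rs = rs
          ; bs-unique = All.tabulate (λ b∈ → All.lookup x∉ (bs⊆ b∈)) ∷ bs-unique
          ; bs⊆ = λ { (here refl) → here refl ; (there b∈) → there (bs⊆ b∈) }
          ; split = λ f → trans (cong (f x +_) (split f)) (sym (+-assoc (f x) _ _))
          ; bs-few = ≤-trans (+-mono-≤ t≤ bs-few) (potential-step x bs)
          ; rs-poor = λ {y} y∈ → ≤-trans (gain-antitone x bs y) (rs-poor y∈) }
        decide (no t≰) = record
          { bs = bs ; rs = x ∷ rs
          ; bs-unique = bs-unique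
          ; bs⊆ = there ∘ bs⊆
          ; split = λ f → trans (cong (f x +_) (split f)) (+-CS.x∙yz≈y∙xz (f x) (∑ bs f) (∑ rs f))
          ; bs-few = bs-few
          ; rs-poor = λ { (here refl) → <⇒≤ (≰⇒> t≰) ; (there y∈) → rs-poor y∈ } }

    -- Since `bs` is small, at most half of `S` is rich. The edges from the poor vertices `us` to a
    -- rejected `x` are what `gain` counts, so `us` sends at most `length S * t` edges to `rs`. A
    -- poor vertex with the fewest such edges has at most `2 * t` of them, and fewer than `M`
    -- neighbours in `bs`.
    low-degree : ∀ {M C} .{{_ : NonZero M}} → FewRich M C → ∀ {S s₀} → Unique S → s₀ ∈ S →
      ∃ λ u → u ∈ S × deg S u ≤ degeneracy M C
    low-degree {M} {C} few-rich {S} {s₀} uS s₀∈ =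
      let u , u∈ , min = minimiser (deg rs) (proj₂ us-nonempty)
          u∈S , poor   = ∈-filter⁻ poor? u∈
      in u , u∈S , (begin
        deg S u                      ≡⟨ split _ ⟩
        deg bs u + deg rs u          ≤⟨ +-mono-≤ (<⇒≤ poor) (*-cancelˡ-≤ (length us) {{>-nonZero us>0}} (begin
          length us * deg rs u                          ≤⟨ ∑-≥const us min ⟩
          ∑ us (λ u → ∑ rs (λ x → 𝟙 (E? u x)))          ≤⟨ us-rs-edges ⟩
          length us * (t * 2)                           ∎)) ⟩
        M + t * 2                    ∎)
      where
      open ≤-Reasoning
      -- Chosen so that `length bs * t ≤ M * length S` becomes `2 * C * length bs ≤ length S`.
      t = M * (2 * C)
      open Greedy (greedy M t S uS)
      rich? : Decidable (λ u → ¬ deg bs u < M)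
      rich? u = ¬? (deg bs u <? M)
      poor? : Decidable (λ u → deg bs u < M)
      poor? u = deg bs u <? M
      as = filter rich? S
      us = filter poor? S
      as≤ : length as ≤ C * length bs
      as≤ = few-rich bs-unique (Unique.filter⁺ rich? uS)
        λ {v} v∈ → subst (M ≤_) (sym (length-filter≡∑ (E? v) bs)) (≮⇒≥ (proj₂ (∈-filter⁻ rich? {xs = S} v∈)))
      bs≤ : 2 * C * length bs ≤ length S
      bs≤ = *-cancelˡ-≤ M (begin
        M * (2 * C * length bs)    ≡⟨ *-assoc M (2 * C) _ ⟨
        t * length bs              ≡⟨ *-comm t _ ⟩
        length bs * t              ≤⟨ bs-few ⟩
        potential M t S bs         ≤⟨ ∑-≤const S (λ _ → m⊓n≤m M _) ⟩
        length S * M               ≡⟨ *-comm (length S) M ⟩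
        M * length S               ∎)
      us+as : length us + length as ≡ length S
      us+as = length-filter-¬ poor? S
      as≤us : length as ≤ length us
      as≤us = +-cancelʳ-≤ (length as) _ _ (begin
        length as + length as      ≤⟨ +-mono-≤ as≤ as≤ ⟩
        C * length bs + C * length bs  ≡⟨ lemma C (length bs) ⟩
        2 * C * length bs          ≤⟨ bs≤ ⟩
        length S                   ≡⟨ us+as ⟨
        length us + length as      ∎)
        where
        lemma : ∀ C b → C * b + C * b ≡ 2 * C * b
        lemma = solve-∀
      S≤2us : length S ≤ length us * 2
      S≤2us = begin
        length S               ≡⟨ us+as ⟨
        length us + length as  ≤⟨ +-monoʳ-≤ (length us) as≤us ⟩
        length us + length us  ≡⟨ lemma (length us) ⟩
        length us * 2          ∎
        where
        lemma : ∀ u → u + u ≡ u * 2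
        lemma = solve-∀
      us>0 : 0 < length us
      us>0 = *-cancelʳ-< 2 0 (length us) (≤-trans (∈-length s₀∈) S≤2us)
      us-nonempty : ∃ (_∈ us)
      us-nonempty with us | us>0
      ... | u ∷ _ | _ = u , here refl
      rs≤ : length rs ≤ length S
      rs≤ = begin
        length rs                            ≤⟨ m≤n+m _ (length bs) ⟩
        length bs + length rs                ≡⟨ cong₂ _+_ (lemma bs) (lemma rs) ⟨
        ∑ bs (λ _ → 1) + ∑ rs (λ _ → 1)      ≡⟨ split _ ⟨
        ∑ S (λ _ → 1)                        ≡⟨ lemma S ⟩
        length S                             ∎
        where
        lemma : ∀ (xs : List V) → ∑ xs (λ _ → 1) ≡ length xs
        lemma xs = trans (∑-const xs 1) (*-identityʳ _)
      us-rs-edges : ∑ us (λ u → ∑ rs (λ x → 𝟙 (E? u x))) ≤ length us * (t * 2)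
      us-rs-edges = begin
        ∑ us (λ u → ∑ rs (λ x → 𝟙 (E? u x)))  ≡⟨ ∑-swap us rs _ ⟩
        ∑ rs (λ x → ∑ us (λ u → 𝟙 (E? u x)))  ≡⟨ ∑-cong rs (λ _ → ∑-filter poor? S _) ⟩
        ∑ rs (gain M t S bs)                  ≤⟨ ∑-≤const rs rs-poor ⟩
        length rs * t                         ≤⟨ *-monoˡ-≤ t rs≤ ⟩
        length S * t                          ≤⟨ *-monoˡ-≤ t S≤2us ⟩
        length us * 2 * t                     ≡⟨ lemma (length us) t ⟩
        length us * (t * 2)                   ∎
        where
        lemma : ∀ u t → u * 2 * t ≡ u * (t * 2)
        lemma = solve-∀

-- Acyclic orientation of bounded out-degree.

module _ {V : Set} (_≟_ : DecidableEquality V) {E : V → V → Set} (E? : ∀ u v → Dec (E u v)) where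

  -- Edges point from larger to smaller rank.
  outdeg : (V → ℕ) → List V → V → ℕ
  outdeg rk S v = ∑ S (λ u → 𝟙 (E? v u ×-dec (rk u <? rk v)))

  record Ranking (S : List V) (m d : ℕ) : Set where
    field
      rk          : V → ℕ
      rk<         : ∀ {v} → v ∈ S → rk v < m
      rk-distinct : ∀ {u v} → u ∈ S → v ∈ S → u ≢ v → rk u ≢ rk v
      outdeg≤     : ∀ {v} → v ∈ S → outdeg rk S v ≤ d

  -- A vertex of low degree in `S` receives the top rank and is removed. Its out-neighbours are
  -- among its few neighbours in `S`, and being ranked above the rest it is an out-neighbour of none
  -- of them.
  ranking : ∀ {d} → (∀ {S s₀} → Unique S → s₀ ∈ S → ∃ λ u → u ∈ S × deg _≟_ E? S u ≤ d) →
    ∀ m {S} → Unique S → length S ≤ m → Ranking S m d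
  ranking low _ {[]} _ _ = record
    { rk = λ _ → 0 ; rk< = λ () ; rk-distinct = λ () ; outdeg≤ = λ () }
  ranking {d} low (suc m) {S@(_ ∷ _)} uS S≤ with v₀ , v₀∈ , low-v₀ ← low uS (here refl) =
    record { rk = rk′ ; rk< = rk′< ; rk-distinct = rk′-distinct ; outdeg≤ = outdeg′≤ }
    where
    other? : Decidable (λ v → v ≢ v₀)
    other? v = ¬? (v ≟ v₀)
    S′ = filter other? S
    open Ranking (ranking low m {S′} (Unique.filter⁺ other? uS)
      (s≤s⁻¹ (≤-trans (filter-notAll other? S (Any.map (λ v₀≡v v≢v₀ → v≢v₀ (sym v₀≡v)) v₀∈)) S≤)))
    rk′ : V → ℕ
    rk′ = _[_≔_] _≟_ rk v₀ m
    rk′-v₀ : rk′ v₀ ≡ m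
    rk′-v₀ = ≔-here _≟_ rk v₀
    rk′-other : ∀ {v} → v ≢ v₀ → rk′ v ≡ rk v
    rk′-other = ≔-there _≟_ rk
    ∈S′ : ∀ {v} → v ∈ S → v ≢ v₀ → v ∈ S′
    ∈S′ = ∈-filter⁺ other?
    rk′-other< : ∀ {v} → v ∈ S → v ≢ v₀ → rk′ v < m
    rk′-other< v∈ v≢ = subst (_< m) (sym (rk′-other v≢)) (rk< (∈S′ v∈ v≢))
    rk′< : ∀ {v} → v ∈ S → rk′ v < suc m
    rk′< {v} v∈ with v ≟ v₀
    ... | yes refl = ≤-refl
    ... | no v≢    = m<n⇒m<1+n (rk< (∈S′ v∈ v≢))
    rk′-distinct : ∀ {u v} → u ∈ S → v ∈ S → u ≢ v → rk′ u ≢ rk′ v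
    rk′-distinct {u} {v} u∈ v∈ u≢v eq with u ≟ v₀ | v ≟ v₀
    ... | yes refl | yes refl = u≢v refl
    ... | yes refl | no v≢    = <⇒≢ (rk< (∈S′ v∈ v≢)) (sym eq)
    ... | no u≢    | yes refl = <⇒≢ (rk< (∈S′ u∈ u≢)) eq
    ... | no u≢    | no v≢    = rk-distinct (∈S′ u∈ u≢) (∈S′ v∈ v≢) u≢v eq
    outdeg′≤ : ∀ {v} → v ∈ S → outdeg rk′ S v ≤ d
    outdeg′≤ {v} v∈ = decide (v ≟ v₀)
      where
      decide : Dec (v ≡ v₀) → outdeg rk′ S v ≤ d
      decide (yes refl) = ≤-trans (∑-mono S λ {u} _ → 𝟙-mono (E? v u ×-dec (rk′ u <? rk′ v)) (E? v u) proj₁) low-v₀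
      decide (no v≢) = begin
        outdeg rk′ S v                                            ≤⟨ ∑-mono S (λ {u} u∈ → outdeg-term u (u ≟ v₀)) ⟩
        ∑ S (λ u → 𝟙 (other? u) * 𝟙 (E? v u ×-dec (rk u <? rk v)))  ≡⟨ ∑-filter other? S _ ⟨
        outdeg rk S′ v                                            ≤⟨ outdeg≤ (∈S′ v∈ v≢) ⟩
        d                                                         ∎
        where
        open ≤-Reasoning
        outdeg-term : ∀ u (u≟v₀ : Dec (u ≡ v₀)) → 𝟙 (E? v u ×-dec (rk′ u <? rk′ v)) ≤
               𝟙 (¬? u≟v₀) * 𝟙 (E? v u ×-dec (rk u <? rk v))
        outdeg-term u (yes refl) = ≤-reflexive (𝟙-no (E? v u ×-dec (rk′ u <? rk′ v))
          λ (_ , lt) → <-asym (rk′-other< v∈ v≢) (subst (_< rk′ v) rk′-v₀ lt))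
        outdeg-term u (no u≢) = ≤-trans
          (𝟙-mono (E? v u ×-dec (rk′ u <? rk′ v)) (E? v u ×-dec (rk u <? rk v))
                  λ (e , lt) → e , subst₂ _<_ (rk′-other u≢) (rk′-other v≢) lt)
          (≤-reflexive (sym (*-identityˡ _)))

-- Greedy colouring along a rank function.

fresh : ∀ (xs : List (Fin n)) → length xs < n → ∃ λ x → ¬ x ∈ xs
fresh {n} xs xs<n = F.¬∀⟶∃¬ n (_∈ xs) (λ x → Any.any? (x F.≟_) xs) λ all →
  let i , j , i<j , eq = F.pigeonhole xs<n (index ∘ all)
  in F.<⇒≢ i<j (trans (lookup-index (all i)) (trans (cong (L.lookup xs) eq) (sym (lookup-index (all j)))))

-- Round `m` recolours all vertices of rank `m` at once. Their lists contain only vertices of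
-- smaller rank, so the colours to be avoided do not change in that round.
greedy-colouring : ∀ {V : Set} {D} (N : V → List V) (rk : V → ℕ) →
  (∀ v → length (N v) ≤ D) → (∀ {u v} → v ∈ N u → rk v < rk u) →
  ∀ m → ∃ λ (c : V → Fin (suc D)) → ∀ {u v} → rk u < m → v ∈ N u → c u ≢ c v
greedy-colouring N rk N≤ N-down zero = (λ _ → zero) , λ ()
greedy-colouring {V} {D} N rk N≤ N-down (suc m) with c , c-good ← greedy-colouring N rk N≤ N-down m = c′ , good
  where
  new : ∀ u → ∃ λ x → ¬ x ∈ map c (N u)
  new u = fresh (map c (N u)) (s≤s (≤-trans (≤-reflexive (length-map c (N u))) (N≤ u)))
  pick : ∀ u → Dec (rk u ≡ m) → Fin (suc D)
  pick u (yes _) = proj₁ (new u)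
  pick u (no _)  = c u
  c′ : V → Fin (suc D)
  c′ u = pick u (rk u ≟ m)
  pick-old : ∀ {v} d → rk v ≢ m → pick v d ≡ c v
  pick-old (yes eq) rk≢ = contradiction eq rk≢
  pick-old (no _)   rk≢ = refl
  pick-good : ∀ {u v} d → rk u < suc m → v ∈ N u → pick u d ≢ c v
  pick-good {u} (yes _) _     v∈ eq = proj₂ (new u) (subst (_∈ map c (N u)) (sym eq) (∈-map⁺ c v∈))
  pick-good (no u≢m)    u<1+m v∈ eq = c-good (≤∧≢⇒< (s≤s⁻¹ u<1+m) u≢m) v∈ eq
  good : ∀ {u v} → rk u < suc m → v ∈ N u → c′ u ≢ c′ v
  good {u} {v} u<1+m v∈ eq = pick-good (rk u ≟ m) u<1+m v∈
    (trans eq (pick-old (rk v ≟ m) (<⇒≢ (<-≤-trans (N-down v∈) (s≤s⁻¹ u<1+m)))))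

-- Star colouring from an orientation.

length-concatMap : ∀ (f : A → List B) xs {k} → (∀ x → length (f x) ≤ k) →
                   length (concatMap f xs) ≤ length xs * k
length-concatMap f []       h = z≤n
length-concatMap f (x ∷ xs) h =
  ≤-trans (≤-reflexive (length-++ (f x))) (+-mono-≤ (h x) (length-concatMap f xs h))

nth : A → List A → Fin n → A
nth y []       _       = y
nth y (x ∷ xs) zero    = x
nth y (x ∷ xs) (suc i) = nth y xs i

nth-surjective : ∀ (y : A) {x xs} → length xs ≤ n → x ∈ xs → ∃ λ (i : Fin n) → nth y xs i ≡ x
nth-surjective y (s≤s xs≤) (here refl) = zero , refl
nth-surjective y (s≤s xs≤) (there x∈)  = let i , eq = nth-surjective y xs≤ x∈ in suc i , eq

funToFin-injective : ∀ {m n} (f g : Fin m → Fin n) → funToFin f ≡ funToFin g → ∀ i → f i ≡ g i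
funToFin-injective f g eq i = trans (sym (F.finToFun-funToFin f i))
  (trans (cong (λ k → finToFun k i) eq) (F.finToFun-funToFin g i))

module _ (G : Graph n) where

  Adj : Fin n → Fin n → Set
  Adj u v = v ∈ₛ adj G u

  Adj? : ∀ u v → Dec (Adj u v)
  Adj? u v = v ∈? adj G u

  star-colouring : ∀ {K m d} → ForkColourable F._≟_ Adj? K → Ranking F._≟_ Adj? (allFin n) m d →
                   χs≤ G (starBound K d)
  star-colouring {K} {m} {d} colour ranking = col , proper , no-bicoloured-path
    where
    open Ranking ranking
    out? : ∀ v → Decidable (λ u → Adj v u × rk u < rk v)
    out? v u = Adj? v u ×-dec (rk u <? rk v)
    out : Fin n → List (Fin n)
    out v = filter (out? v) (allFin n)
    out≤ : ∀ v → length (out v) ≤ d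
    out≤ v = ≤-trans (≤-reflexive (length-filter≡∑ (out? v) (allFin n))) (outdeg≤ (∈-allFin v))
    ∈-out⁻ : ∀ {u v} → u ∈ out v → Adj v u × rk u < rk v
    ∈-out⁻ {v = v} = proj₂ ∘ ∈-filter⁻ (out? v) {xs = allFin n}
    oriented : ∀ {u v} → Adj u v → v ∈ out u ⊎ u ∈ out v
    oriented {u} {v} uv with <-cmp (rk u) (rk v)
    ... | tri< u<v _ _ = inj₂ (∈-filter⁺ (out? v) (∈-allFin u) (adj-sym G v u uv , u<v))
    ... | tri> _ _ v<u = inj₁ (∈-filter⁺ (out? u) (∈-allFin v) (uv , v<u))
    ... | tri≈ _ u≈v _ = contradiction u≈v
          (rk-distinct (∈-allFin u) (∈-allFin v) λ { refl → irrefl G u uv })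

    out² : Fin n → List (Fin n)
    out² v = out v ++ concatMap out (out v)
    out²≤ : ∀ v → length (out² v) ≤ d + d * d
    out²≤ v = ≤-trans (≤-reflexive (length-++ (out v)))
      (+-mono-≤ (out≤ v) (≤-trans (length-concatMap out (out v) out≤) (*-monoˡ-≤ d (out≤ v))))
    step₁ : ∀ {u v} → v ∈ out u → v ∈ out² u
    step₁ = ∈-++⁺ˡ
    step₂ : ∀ {u v w} → v ∈ out u → w ∈ out v → w ∈ out² u
    step₂ {u} v∈ w∈ = ∈-++⁺ʳ (out u) (∈-concatMap⁺ out (Any.map (λ { refl → w∈ }) v∈))
    out²-down : ∀ {u v} → v ∈ out² u → rk v < rk u
    out²-down {u} v∈ with ∈-++⁻ (out u) v∈
    ... | inj₁ v∈out = proj₂ (∈-out⁻ v∈out)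
    ... | inj₂ v∈out² with w , w∈ , v∈w ← find (∈-concatMap⁻ out {xs = out u} v∈out²) =
          <-trans (proj₂ (∈-out⁻ v∈w)) (proj₂ (∈-out⁻ w∈))

    greedy-col : ∃ λ (c : Fin n → Fin (suc (d + d * d))) → ∀ {u v} → rk u < m → v ∈ out² u → c u ≢ c v
    greedy-col = greedy-colouring out² rk out²≤ out²-down m
    c₁ : Fin n → Fin (suc (d + d * d))
    c₁ = proj₁ greedy-col
    c₁-good : ∀ {u v} → v ∈ out² u → c₁ u ≢ c₁ v
    c₁-good {u} = proj₂ greedy-col (rk< (∈-allFin u))

    pick : Fin d → Fin n → Fin n
    -- Past the end of `out v` the value is `v`, which is not its own neighbour, so `fork-col`
    -- demands nothing there.
    pick i v = nth v (out v) i
    fork-col : ∀ i j → ∃ λ (c : Fin n → Fin (suc K)) →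
      ∀ v → Adj v (pick i v) → Adj v (pick j v) → pick i v ≢ pick j v → c (pick i v) ≢ c (pick j v)
    fork-col i j = colour (pick i) (pick j)
    row : Fin n → Fin d → Fin (suc K ^ d)
    row v i = funToFin (λ j → proj₁ (fork-col i j) v)
    c₂ : Fin n → Fin ((suc K ^ d) ^ d)
    c₂ v = funToFin (row v)
    c₂-good : ∀ {u v w} → v ∈ out u → w ∈ out u → v ≢ w → c₂ v ≢ c₂ w
    c₂-good {u} {v} {w} v∈ w∈ v≢w eq
      -- The positions of `v` and `w` in `out u` select the coordinate `(i , j)`, whose colouring
      -- separates them.
      with i , refl ← nth-surjective u (out≤ u) v∈
         | j , refl ← nth-surjective u (out≤ u) w∈ =
      proj₂ (fork-col i j) u (proj₁ (∈-out⁻ v∈)) (proj₁ (∈-out⁻ w∈)) v≢w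
        (funToFin-injective _ _ (funToFin-injective (row v) (row w) eq i) j)

    col : Fin n → Fin (starBound K d)
    col v = combine (c₁ v) (c₂ v)
    col-c₁ : ∀ {u v} → col u ≡ col v → c₁ u ≡ c₁ v
    col-c₁ {u} {v} = F.combine-injectiveˡ (c₁ u) (c₂ u) (c₁ v) (c₂ v)
    col-c₂ : ∀ {u v} → col u ≡ col v → c₂ u ≡ c₂ v
    col-c₂ {u} {v} = F.combine-injectiveʳ (c₁ u) (c₂ u) (c₁ v) (c₂ v)

    proper : IsProper G col
    proper u v uv eq with oriented uv
    ... | inj₁ v∈ = c₁-good (step₁ v∈) (col-c₁ eq)
    ... | inj₂ u∈ = c₁-good (step₁ u∈) (sym (col-c₁ eq))

    -- If y → x then x, z form a fork at y, handled by c₂; if x → y then z ∈ out² x.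
    out-neighbour-unique : ∀ {x y z} → Adj x y → z ∈ out y → x ≢ z → col x ≢ col z
    out-neighbour-unique xy z∈ x≢z eq with oriented xy
    ... | inj₁ y∈ = c₁-good (step₂ y∈ z∈) (col-c₁ eq)
    ... | inj₂ x∈ = c₂-good x∈ z∈ x≢z (col-c₂ eq)

    -- Orient the middle edge. Its head is an out-neighbour of its tail, and the end of the path
    -- beyond the tail is another neighbour of the tail, so these two differ in colour by
    -- `out-neighbour-unique`.
    no-bicoloured-path : ∀ a b x e → a ≢ x → b ≢ e → a ≢ e → Adj a b → Adj b x → Adj x e →
                         ¬ (col a ≡ col x × col b ≡ col e)
    no-bicoloured-path a b x e a≢x b≢e _ ab bx xe (eq₁ , eq₂) with oriented bx
    ... | inj₁ x∈ = out-neighbour-unique ab x∈ a≢x eq₁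
    ... | inj₂ b∈ = out-neighbour-unique (adj-sym G e x xe) b∈ (b≢e ∘ sym) (sym eq₂)

  fork⇒star : ∀ {K} → ForkColourable F._≟_ Adj? K → χs≤ G (starBound K (degeneracy (2 + K) (slope K)))
  fork⇒star {K} colour = star-colouring colour
    (ranking F._≟_ Adj? (low-degree F._≟_ Adj? {M = 2 + K} {C = slope K} (few-rich F._≟_ Adj? colour))
      n (Unique.allFin⁺ n) (≤-reflexive (length-tabulate {n = n} (λ i → i))))

-- Sizes of subsets, and forks as neighbourhood systems.

x∈p⇒0<∣p∣ : ∀ {p : Subset n} {x} → x ∈ₛ p → 0 < ∣ p ∣
x∈p⇒0<∣p∣ {p = p} {x} x∈p = ≤-trans (s≤s z≤n) (x∈p⇒∣p-x∣<∣p∣ x∈p)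

x≢y∈p⇒1<∣p∣ : ∀ {p : Subset n} {x y} → x ∈ₛ p → y ∈ₛ p → x ≢ y → 1 < ∣ p ∣
x≢y∈p⇒1<∣p∣ x∈p y∈p x≢y =
  ≤-trans (s≤s (x∈p⇒0<∣p∣ (x∈p∧x≢y⇒x∈p-y y∈p (x≢y ∘ sym)))) (x∈p⇒∣p-x∣<∣p∣ x∈p)

∣p∪q∣≤∣p∣+∣q∣ : ∀ (p q : Subset n) → ∣ p ∪ q ∣ ≤ ∣ p ∣ + ∣ q ∣
∣p∪q∣≤∣p∣+∣q∣ []            []            = z≤n
∣p∪q∣≤∣p∣+∣q∣ (inside  ∷ p) (inside  ∷ q) =
  s≤s (≤-trans (∣p∪q∣≤∣p∣+∣q∣ p q) (+-monoʳ-≤ ∣ p ∣ (n≤1+n ∣ q ∣)))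
∣p∪q∣≤∣p∣+∣q∣ (inside  ∷ p) (outside ∷ q) = s≤s (∣p∪q∣≤∣p∣+∣q∣ p q)
∣p∪q∣≤∣p∣+∣q∣ (outside ∷ p) (inside  ∷ q) =
  ≤-trans (s≤s (∣p∪q∣≤∣p∣+∣q∣ p q)) (≤-reflexive (sym (+-suc ∣ p ∣ ∣ q ∣)))
∣p∪q∣≤∣p∣+∣q∣ (outside ∷ p) (outside ∷ q) = ∣p∪q∣≤∣p∣+∣q∣ p q

members : Subset n → List (Fin n)
members []            = []
members (inside  ∷ p) = zero ∷ map suc (members p)
members (outside ∷ p) = map suc (members p)

length-members : ∀ (p : Subset n) → length (members p) ≡ ∣ p ∣
length-members []            = refl
length-members (inside  ∷ p) = cong suc (trans (length-map suc (members p)) (length-members p))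
length-members (outside ∷ p) = trans (length-map suc (members p)) (length-members p)

∈-members : ∀ {p : Subset n} {x} → x ∈ₛ p → x ∈ members p
∈-members {p = inside  ∷ p} here        = here refl
∈-members {p = inside  ∷ p} (there x∈p) = there (∈-map⁺ suc (∈-members x∈p))
∈-members {p = outside ∷ p} (there x∈p) = ∈-map⁺ suc (∈-members x∈p)

≤maxFin : ∀ (f : Fin n → ℕ) i → f i ≤ maxFin f
≤maxFin f zero    = m≤m⊔n _ _
≤maxFin f (suc i) = ≤-trans (≤maxFin (f ∘ suc) i) (m≤n⊔m (f zero) _)

maxFin≤ : ∀ (f : Fin n → ℕ) {k} → (∀ i → f i ≤ k) → maxFin f ≤ k
maxFin≤ {zero}  f h = z≤n
maxFin≤ {suc n} f h = ⊔-lub (h zero) (maxFin≤ (f ∘ suc) (h ∘ suc))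

∣nbh∣≤ρ : ∀ {G : Graph n} (S : NbhSystem G) v → ∣ nbh S v ∣ ≤ ρ S
∣nbh∣≤ρ S v = ≤maxFin (λ v → ∣ nbh S v ∣) v

χ≤-ρ≤1 : ∀ {G : Graph n} (S : NbhSystem G) → ρ S ≤ 1 → ∀ {K} → χ≤ S (suc K)
χ≤-ρ≤1 S ρ≤1 = (λ _ → zero) , λ w u v u∈ v∈ u≢v _ →
  <⇒≱ (x≢y∈p⇒1<∣p∣ u∈ v∈ u≢v) (≤-trans (∣nbh∣≤ρ S w) ρ≤1)

χ≤-mono : ∀ {G : Graph n} (S : NbhSystem G) {k l} → k ≤ l → χ≤ S k → χ≤ S l
χ≤-mono S k≤l (c , c-good) = (λ v → inject≤ (c v) k≤l) , λ w u v u∈ v∈ u≢v eq →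
  c-good w u v u∈ v∈ u≢v (F.inject≤-injective k≤l k≤l _ _ eq)

χ₂⇒fork : ∀ (G : Graph n) {K} → (∀ S → ρ {G = G} S ≡ 2 → χ≤ S K) → ForkColourable F._≟_ (Adj? G) K
χ₂⇒fork {n} G {K} χ₂ f g = c , λ v fv gv f≢g →
  c-good v (f v) (g v) (x∈p∩q⁺ (x∈p∪q⁺ (inj₁ (x∈⁅x⁆ (f v))) , fv)) (x∈p∩q⁺ (x∈p∪q⁺ (inj₂ (x∈⁅x⁆ (g v))) , gv)) f≢g
  where
  pair : Fin n → Subset n
  pair v = (⁅ f v ⁆ ∪ ⁅ g v ⁆) ∩ adj G v
  ∣pair∣≤2 : ∀ v → ∣ pair v ∣ ≤ 2
  ∣pair∣≤2 v = ≤-trans (∣p∩q∣≤∣p∣ (⁅ f v ⁆ ∪ ⁅ g v ⁆) (adj G v))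
    (≤-trans (∣p∪q∣≤∣p∣+∣q∣ ⁅ f v ⁆ ⁅ g v ⁆) (≤-reflexive (cong₂ _+_ (∣⁅x⁆∣≡1 (f v)) (∣⁅x⁆∣≡1 (g v)))))
  S : NbhSystem G
  S = record { nbh = pair ; sub = λ v u u∈ → proj₂ (x∈p∩q⁻ (⁅ f v ⁆ ∪ ⁅ g v ⁆) (adj G v) u∈) }
  colouring : χ≤ S (suc K)
  -- The hypothesis covers only `ρ` equal to 2. For smaller `ρ` one colour is enough, and `suc K`
  -- supplies it even when `K` is 0.
  colouring with m≤n⇒m<n∨m≡n (maxFin≤ (λ v → ∣ pair v ∣) ∣pair∣≤2)
  ... | inj₁ ρ<2 = χ≤-ρ≤1 S (s≤s⁻¹ ρ<2)
  ... | inj₂ ρ≡2 = χ≤-mono S (n≤1+n K) (χ₂ S ρ≡2)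
  c = proj₁ colouring
  c-good = proj₂ colouring

-- A star colouring gives the linear bound.

star⇒linear : ∀ {G : Graph n} {K} → χs≤ G K → (S : NbhSystem G) → 1 ≤ ρ S → χ≤ S (K * suc K * ρ S)
star⇒linear {n} {G} {K} (c , proper , no-path) S 1≤ρ = χ≤-mono S bound (col , col-good)
  where
  Rival : Fin n → Fin n → Fin n → Set
  Rival w u v = u ∈ₛ nbh S w × v ∈ₛ nbh S w × u ≢ v × c u ≡ c v

  -- two distinct centres of the same colour would give a bicoloured path on four vertices
  centre-unique : ∀ {u v v′ w w′} → Rival w u v → Rival w′ u v′ → c w ≡ c w′ → w ≡ w′
  centre-unique {u} {v} {v′} {w} {w′} (u∈w , v∈w , u≢v , cu≡cv) (u∈w′ , _) cw≡cw′ with w F.≟ w′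
  ... | yes w≡w′ = w≡w′
  ... | no w≢w′  = contradiction (sym cu≡cv , cw≡cw′)
        (no-path v w u w′ (u≢v ∘ sym) w≢w′ v≢w′ (adj-sym G v w wv) (sub S w u u∈w)
                 (adj-sym G u w′ (sub S w′ u u∈w′)))
    where
    wv = sub S w v v∈w
    v≢w′ : v ≢ w′
    v≢w′ refl = proper w v wv cw≡cw′

  Centre : Fin n → Fin K → Fin n → Set
  Centre u j w = c w ≡ j × ∃ (Rival w u)
  centre? : ∀ u j → Dec (∃ (Centre u j))
  centre? u j = F.any? λ w → (c w F.≟ j) ×-dec F.any? λ v →
    (u ∈? nbh S w) ×-dec (v ∈? nbh S w) ×-dec ¬? (u F.≟ v) ×-dec (c u F.≟ c v)

  -- By `centre-unique` the rivals of `u` with centres of colour `j` all share one centre, so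
  -- listing its whole neighbourhood set captures them with at most `ρ S` entries.
  block : ∀ {u j} → Dec (∃ (Centre u j)) → List (Fin n)
  block (yes (w , _)) = members (nbh S w)
  block (no _)        = []
  block≤ : ∀ {u j} (d : Dec (∃ (Centre u j))) → length (block d) ≤ ρ S
  block≤ (yes (w , _)) = ≤-trans (≤-reflexive (length-members (nbh S w))) (∣nbh∣≤ρ S w)
  block≤ (no _)        = z≤n
  ∈-block : ∀ {u v w} (d : Dec (∃ (Centre u (c w)))) → Rival w u v → v ∈ block d
  ∈-block (yes (w′ , eq , _ , r′)) r@(_ , v∈ , _) =
    ∈-members (subst (λ w → _ ∈ₛ nbh S w) (sym (centre-unique r′ r eq)) v∈)
  ∈-block (no ¬centre)             r = contradiction (_ , refl , _ , r) ¬centre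

  rivals : Fin n → List (Fin n)
  rivals u = concatMap (λ j → block (centre? u j)) (allFin K)
  earlier? : ∀ (u : Fin n) → Decidable (λ (v : Fin n) → toℕ v < toℕ u)
  earlier? u v = toℕ v <? toℕ u
  earlier : Fin n → List (Fin n)
  earlier u = filter (earlier? u) (rivals u)
  earlier≤ : ∀ u → length (earlier u) ≤ K * ρ S
  earlier≤ u = ≤-trans (length-filter (earlier? u) (rivals u))
    (≤-trans (length-concatMap _ (allFin K) (λ j → block≤ (centre? u j)))
             (≤-reflexive (cong (_* ρ S) (length-tabulate {n = K} (λ i → i)))))
  -- The numbering of the vertices serves as rank; since rivalry is symmetric, it is enough to avoid
  -- earlier rivals.
  greedy-col = greedy-colouring earlier toℕ earlier≤
    (λ {u} v∈ → proj₂ (∈-filter⁻ (earlier? u) {xs = rivals u} v∈)) n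
  g : Fin n → Fin (suc (K * ρ S))
  g = proj₁ greedy-col
  g-good : ∀ {u v w} → Rival w u v → toℕ v < toℕ u → g u ≢ g v
  g-good {u} {v} {w} r v<u = proj₂ greedy-col (F.toℕ<n u)
    (∈-filter⁺ (earlier? u) (∈-concatMap⁺ _ (lose (∈-allFin (c w)) (∈-block (centre? u (c w)) r))) v<u)

  col : Fin n → Fin (K * suc (K * ρ S))
  col v = combine (c v) (g v)
  col-good : IsΣColoring S col
  col-good w u v u∈ v∈ u≢v eq with F.combine-injective (c u) (g u) (c v) (g v) eq | <-cmp (toℕ u) (toℕ v)
  ... | cu≡cv , gu≡gv | tri< u<v _ _ = g-good (v∈ , u∈ , u≢v ∘ sym , sym cu≡cv) u<v (sym gu≡gv)
  ... | cu≡cv , gu≡gv | tri> _ _ v<u = g-good (u∈ , v∈ , u≢v , cu≡cv) v<u gu≡gv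
  ... | _             | tri≈ _ eq′ _ = u≢v (F.toℕ-injective eq′)

  bound : K * suc (K * ρ S) ≤ K * suc K * ρ S
  bound = begin
    -- The additive 1 is absorbed using `1 ≤ ρ S`.
    K * (1 + K * ρ S)      ≤⟨ *-monoʳ-≤ K (+-monoˡ-≤ (K * ρ S) 1≤ρ) ⟩
    K * (suc K * ρ S)      ≡⟨ *-assoc K (suc K) (ρ S) ⟨
    K * suc K * ρ S        ∎
    where open ≤-Reasoning

-- The cycle of implications.

linear⇒σ : (F : GraphClass) → LinearlyσBounded F → σBounded F
linear⇒σ F (C , linear) = f , λ G FG S → bounded G FG S (ρ S) refl
  where
  f : ℕ → ℕ
  -- The linear bound is silent when `ρ S` is 0; a constant colouring covers that case.
  f zero    = 1
  f (suc r) = C * suc r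
  bounded : ∀ {n} (G : Graph n) → F G → (S : NbhSystem G) → ∀ r → ρ S ≡ r → χ≤ S (f r)
  bounded G FG S zero    ρ≡0 = χ≤-ρ≤1 S (≤-trans (≤-reflexive ρ≡0) z≤n)
  bounded G FG S (suc r) ρ≡  = subst (λ r → χ≤ S (C * r)) ρ≡ (linear G FG S (subst (1 ≤_) (sym ρ≡) (s≤s z≤n)))

σ⇒σ₂ : (F : GraphClass) → σBounded F → σ₂Bounded F
σ⇒σ₂ F (f , bounded) = f 2 , λ G FG S ρ≡2 → subst (λ r → χ≤ S (f r)) ρ≡2 (bounded G FG S)

σ₂⇒star : (F : GraphClass) → σ₂Bounded F → BoundedStarChromatic F
σ₂⇒star F (K , bounded) = starBound K (degeneracy (2 + K) (slope K)) ,
  λ G FG → fork⇒star G (χ₂⇒fork G (bounded G FG))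

star⇒linearF : (F : GraphClass) → BoundedStarChromatic F → LinearlyσBounded F
star⇒linearF F (K , bounded) = K * suc K , λ G FG S → star⇒linear (bounded G FG) S

theorem1 : (F : GraphClass) →
    (LinearlyσBounded F ⇔ σBounded F) ×
    (σBounded F ⇔ σ₂Bounded F) ×
    (σ₂Bounded F ⇔ BoundedStarChromatic F)
theorem1 F =
  mk⇔ (linear⇒σ F) (star⇒linearF F ∘ σ₂⇒star F ∘ σ⇒σ₂ F) ,
  mk⇔ (σ⇒σ₂ F) (linear⇒σ F ∘ star⇒linearF F ∘ σ₂⇒star F) ,
  mk⇔ (σ₂⇒star F) (σ⇒σ₂ F ∘ linear⇒σ F ∘ star⇒linearF F)
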